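{- Let $m$ be a positive integer, $q=2^m$, and let $n$ be an odd positive integer. Let $L(x)\in\mathbb{F}_q[x]$ be a linearized polynomial such that $xL(x)$ is a permutation polynomial over $\mathbb{F}_q$, and let $g(x)\in\mathbb{F}_q[x]$ be the compositional inverse of $xL(x)$ over $\mathbb{F}_q$. Let $a\in\mathbb{F}_q^*$ and let \[F(x)=x\left(L(\mathrm{Tr}(x))+a\,\mathrm{Tr}(x)+ax\right),\] which is a permutation polynomial over $\mathbb{F}_{q^n}$. Then the compositional inverse of $F$ over $\mathbb{F}_{q^n}$ is \begin{align*} F^{ -1}(x)={}&a^{2^{m-1}-1}x^{2^{nm-1}}\\ &+\left(g(\mathrm{Tr}(x))+a^{2^{m-1}-1}\sum_{k=1}^{\frac{n-1}{2}}x^{2^{(2k-1)m-1}}\right)\left(\frac{\mathrm{Tr}(x)}{g(\mathrm{Tr}(x))}+a\,g(\mathrm{Tr}(x))\right)^{q-1}\\ &+\sum_{j=0}^{m-2}a^{2^{j}-1}\left(\frac{\mathrm{Tr}(x)}{g(\mathrm{Tr}(x))}+a\,g(\mathrm{Tr}(x))\right)^{2^m-2^{j+1}}\left(\sum_{k=0}^{\frac{n-1}{2}}x^{q^{2k}}\right)^{2^j}. \end{align*}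
   Context: $\mathrm{Tr}(x)=\sum_{i=0}^{n-1}x^{q^i}$ is the trace map from $\mathbb{F}_{q^n}$ to $\mathbb{F}_q$. A linearized polynomial over $\mathbb{F}_q=\mathbb{F}_{2^m}$ is here a polynomial of the form $L(x)=\sum_{i=0}^{m-1}l_ix^{2^i}$ with $l_i\in\mathbb{F}_q$. A polynomial over a finite field $K$ is a permutation polynomial over $K$ if the map $K\to K$ it induces is bijective; its compositional inverse over $K$ is the polynomial (unique modulo $x^{|K|}-x$) inducing the inverse map, so identities between polynomials over $K$ are understood modulo $x^{|K|}-x$, i.e. as identities of maps on $K$. Convention for fractions: $\frac{1}{0}$ is interpreted as $0$ (so $\frac1y$ stands for $y^{q^n-2}$ on $\mathbb{F}_{q^n}$); in particular $\frac{\mathrm{Tr}(x)}{g(\mathrm{Tr}(x))}=0$ when $g(\mathrm{Tr}(x))=0$. Empty sums are $0$. That $F$ is a permutation polynomial over $\mathbb{F}_{q^n}$ is a known result (Laigle-Chapuy). -}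

module Defs where

open import Level using (Level; _⊔_) renaming (suc to lsuc)
open import Algebra.Apartness.Bundles using (HeytingField; HeytingCommutativeRing)
open import Algebra.Bundles using (CommutativeRing)
open import Algebra.Morphism.Structures using (IsRingHomomorphism)
open import Data.Fin.Base using (Fin; toℕ)
open import Data.Fin.Properties using (any?) renaming (_≟_ to _≟ᶠ_)
open import Data.List.Base using (List; foldr; map)
open import Data.Nat.Base as ℕ using (ℕ; suc; _∸_)
open import Data.Product.Base using (_,_)
open import Data.Vec.Functional using (Vector)
open import Function.Base using (_∘_)
open import Function.Bundles using (Inverse)
open import Function.Definitions using (Bijective; Inverseᵇ)
open import Function.Properties.Inverse using (Inverse⇒Injection)
import Function.Construct.Symmetry as Symmetry
open import Relation.Binary.Definitions using (Decidable)
open import Relation.Binary.PropositionalEquality using () renaming (setoid to ≡-setoid)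
open import Relation.Nullary.Decidable.Core using (yes; no)
open import Relation.Nullary.Decidable using (via-injection)

-- A field with exactly N elements (up to its equality _≈_).  The enumeration
-- makes _≈_ decidable, so the apartness x # y is just the negation of x ≈ y.
record FiniteField (c ℓ₁ ℓ₂ : Level) (N : ℕ) : Set (lsuc (c ⊔ ℓ₁ ⊔ ℓ₂)) where
  field
    heytingField : HeytingField c ℓ₁ ℓ₂

  open HeytingField heytingField public using (_#_; heytingCommutativeRing)
  open HeytingCommutativeRing heytingCommutativeRing public using (commutativeRing)
  open CommutativeRing commutativeRing public

  field
    enumeration : Inverse (≡-setoid (Fin N)) setoid

  open import Algebra.Properties.Semiring.Exp semiring public using (_^_)
  open import Algebra.Properties.CommutativeMonoid.Sum +-commutativeMonoid public
    using (sum; sum-syntax)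

  element : Fin N → Carrier
  element = Inverse.to enumeration

  infix 4 _≟_
  _≟_ : Decidable _≈_
  _≟_ = via-injection (Inverse⇒Injection (Symmetry.inverse enumeration)) _≟ᶠ_

  -- The search fails only at 0, so this is the inverse extended by 1/0 = 0.
  infix 8 _⁻¹
  _⁻¹ : Carrier → Carrier
  x ⁻¹ with any? (λ i → x * element i ≟ 1#)
  ... | yes (i , _) = element i
  ... | no _        = 0#

  infixl 7 _/_
  _/_ : Carrier → Carrier → Carrier
  x / y = x * y ⁻¹

  -- Polynomials are coefficient lists, constant term first.
  eval : List Carrier → Carrier → Carrier
  eval p x = foldr (λ c r → c + x * r) 0# p

  linearized : ∀ {m} → Vector Carrier m → Carrier → Carrier
  linearized {m} l x = ∑[ i < m ] (l i * x ^ (2 ℕ.^ toℕ i))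

  -- Since polynomials over a finite field are considered modulo X^N - X, the
  -- two notions below are stated for the maps they induce.
  IsPermutation : (Carrier → Carrier) → Set (c ⊔ ℓ₁)
  IsPermutation f = Bijective _≈_ _≈_ f

  IsCompositionalInverse : (Carrier → Carrier) → (Carrier → Carrier) → Set (c ⊔ ℓ₁)
  IsCompositionalInverse f h = Inverseᵇ _≈_ _≈_ f h

module _ {c ℓ₁ ℓ₂ c′ ℓ₁′ ℓ₂′ : Level} {M N : ℕ} where

  -- Injectivity is automatic for a unital homomorphism between fields.
  IsFieldEmbedding : (k : FiniteField c ℓ₁ ℓ₂ M) (K : FiniteField c′ ℓ₁′ ℓ₂′ N) →
                     (FiniteField.Carrier k → FiniteField.Carrier K) → Set (c ⊔ ℓ₁ ⊔ ℓ₁′)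
  IsFieldEmbedding k K = IsRingHomomorphism (rawRing k) (rawRing K)
    where open FiniteField

-- k = 𝔽_q and K = 𝔽_{qⁿ} with q = 2ᵐ.  Polynomials over k act on K through
-- the inclusion ι.
module Inversion
  {c ℓ₁ ℓ₂ c′ ℓ₁′ ℓ₂′ : Level} (m n : ℕ)
  (k : FiniteField c ℓ₁ ℓ₂ (2 ℕ.^ m))
  (K : FiniteField c′ ℓ₁′ ℓ₂′ ((2 ℕ.^ m) ℕ.^ n))
  (ι : FiniteField.Carrier k → FiniteField.Carrier K)
  where

  private
    module k = FiniteField k

  open FiniteField K

  private
    q : ℕ
    q = 2 ℕ.^ m

    h : ℕ
    h = (n ∸ 1) ℕ./ 2

  Tr : Carrier → Carrier
  Tr x = ∑[ i < n ] (x ^ (q ℕ.^ toℕ i))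

  F : Vector k.Carrier m → k.Carrier → Carrier → Carrier
  F l a₀ x = x * (linearized (ι ∘ l) (Tr x) + a * Tr x + a * x)
    where a = ι a₀

  -- The sum over k = 1, …, (n-1)/2 is indexed by i = k - 1.
  F⁻¹ : List k.Carrier → k.Carrier → Carrier → Carrier
  F⁻¹ g a₀ x =
      a ^ (2 ℕ.^ (m ∸ 1) ∸ 1) * x ^ (2 ℕ.^ (n ℕ.* m ∸ 1))
    + (gT + a ^ (2 ℕ.^ (m ∸ 1) ∸ 1)
            * (∑[ i < h ] (x ^ (2 ℕ.^ ((2 ℕ.* suc (toℕ i) ∸ 1) ℕ.* m ∸ 1)))))
      * (Tr x / gT + a * gT) ^ (q ∸ 1)
    + ∑[ j < m ∸ 1 ]
        ( a ^ (2 ℕ.^ toℕ j ∸ 1)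
        * (Tr x / gT + a * gT) ^ (2 ℕ.^ m ∸ 2 ℕ.^ suc (toℕ j))
        * (∑[ i < suc h ] (x ^ (q ℕ.^ (2 ℕ.* toℕ i)))) ^ (2 ℕ.^ toℕ j))
    where
    a  = ι a₀
    gT = eval (map ι g) (Tr x)

{-# OPTIONS --safe #-}

-- Write y = F(x), T = Tr(x) and b = L(T) + aT.  As T lies in 𝔽_q, so does b, and y = bx + ax².
-- Since n is odd, Tr(y) = bT + aT² = T L(T), whence g(Tr(y)) = T and the repeated factor
-- Tr(y)/g(Tr(y)) + a g(Tr(y)) equals b.  Each Frobenius conjugate of x satisfies the same
-- quadratic relation as x, so with S the sum of the x^{q^{2k}}, the sum over j telescopes to
-- b^{q-1} S + a^{2^{m-1}-1} b^{2^{m-1}} S^{2^{m-1}}, and the other two terms are linear combinations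
-- of square roots of conjugates of y.  In characteristic 2 everything cancels except x.
-- Hence F is injective, thus bijective by finiteness, and F⁻¹ is a two-sided inverse.
module Submission where

open import Defs
open import Algebra.Apartness.Bundles using (HeytingCommutativeRing; HeytingField)
open import Algebra.Bundles using (CommutativeMonoid; CommutativeRing)
import Algebra.Morphism.Structures as Morphism
import Algebra.Properties.CommutativeMonoid.Sum as Sum
import Algebra.Properties.CommutativeSemiring.Exp as CommutativeExp
import Algebra.Properties.Group as GroupProperties
import Algebra.Properties.Ring as RingProperties
import Algebra.Properties.Semiring.Exp as Exp
import Algebra.Properties.Semiring.Mult as Mult
import Algebra.Properties.Semiring.Sum as SemiringSum
import Algebra.Solver.CommutativeMonoid as CommutativeMonoidSolver
import Algebra.Solver.Ring
open import Algebra.Solver.Ring.AlmostCommutativeRing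
  using (fromCommutativeRing; _-Raw-AlmostCommutative⟶_)
import Algebra.Solver.Ring.NaturalCoefficients.Default as NaturalSolver
open import Data.Bool.Base using (Bool; true; false)
open import Data.Bool.Properties using (xor-∧-commutativeRing) renaming (_≟_ to _≟ᵇ_)
open import Data.Fin.Base using (Fin; zero; suc; toℕ; punchIn)
open import Data.Fin.Permutation using (permutation; _⟨$⟩ʳ_)
open import Data.Fin.Properties using (any?; injective⇒≤; punchInᵢ≢i; suc-injective; toℕ<n)
open import Data.List.Base using (List; []; _∷_; map)
import Data.Maybe.Base as Maybe
open import Data.Nat.Base as ℕ using (ℕ; zero; suc; s≤s; z≤n)
open import Data.Nat.Divisibility using (_∤_; _∣0; divides)
open import Data.Nat.DivMod using (m≡m%n+[m/n]*n; m%n<n)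
import Data.Nat.Properties as ℕ
open import Data.Product.Base using (∃-syntax; _×_; _,_; proj₁; proj₂)
open import Data.Vec.Base as Vec using (Vec; []; _∷_)
open import Data.Vec.Functional using (Vector)
open import Function.Base using (_∘_)
open import Function.Bundles using (Inverse)
open import Function.Definitions using (Congruent; Injective)
open import Level using (Level)
open import Relation.Binary.Consequences using (dec⇒weaklyDec)
open import Relation.Binary.PropositionalEquality as ≡ using (_≡_; _≢_)
import Relation.Binary.Reasoning.Setoid as SetoidReasoning
open import Relation.Nullary.Decidable.Core using (yes; no)
open import Relation.Nullary.Negation.Core using (¬_; contradiction)

-- Arithmetic of powers of two and parity.

-- Matches the exponents of `b` in consecutive terms of the telescoping sum. The bound on `j` gives
-- `2 ^ suc j ≤ 2 ^ m`, so the truncated subtractions are exact.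
2^m∸2^[1+j]+2^j≡2^m∸2^j : ∀ {j m} → suc j ℕ.≤ m →
  2 ℕ.^ m ℕ.∸ 2 ℕ.^ suc j ℕ.+ 2 ℕ.^ j ≡ 2 ℕ.^ m ℕ.∸ 2 ℕ.^ j
2^m∸2^[1+j]+2^j≡2^m∸2^j {j} {m} j<m = begin
  q ℕ.∸ 2 ℕ.^ suc j ℕ.+ p  ≡⟨ ≡.cong (λ r → q ℕ.∸ (p ℕ.+ r) ℕ.+ p) (ℕ.+-identityʳ p) ⟩
  q ℕ.∸ (p ℕ.+ p) ℕ.+ p    ≡⟨ ≡.cong (ℕ._+ p) (ℕ.∸-+-assoc q p p) ⟨
  q ℕ.∸ p ℕ.∸ p ℕ.+ p      ≡⟨ ℕ.m∸n+n≡m p≤q∸p ⟩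
  q ℕ.∸ p                  ∎
  where
  open ≡.≡-Reasoning
  q = 2 ℕ.^ m
  p = 2 ℕ.^ j
  p≤q∸p : p ℕ.≤ q ℕ.∸ p
  p≤q∸p = ℕ.m+n≤o⇒m≤o∸n p
    (≡.subst (ℕ._≤ q) (≡.cong (p ℕ.+_) (ℕ.+-identityʳ p)) (ℕ.^-monoʳ-≤ 2 j<m))

2∤n⇒n≡1+2h : ∀ n → 2 ∤ n → n ≡ suc (2 ℕ.* ((n ℕ.∸ 1) ℕ./ 2))
2∤n⇒n≡1+2h zero    2∤0 = contradiction (2 ∣0) 2∤0
-- From here `n` is the predecessor of the odd number, so remainder 0 is the possible case and
-- remainder 1 the contradictory one.
2∤n⇒n≡1+2h (suc n) 2∤1+n with n ℕ.% 2 | m%n<n n 2 | m≡m%n+[m/n]*n n 2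
... | 0 | _ | n≡ = ≡.cong suc (≡.trans n≡ (ℕ.*-comm (n ℕ./ 2) 2))
... | 1 | _ | n≡ = contradiction (divides (suc (n ℕ./ 2)) (≡.cong suc n≡)) 2∤1+n
... | suc (suc _) | s≤s (s≤s ()) | _

-- Finite sums in a commutative monoid.

module _ {c ℓ} (M : CommutativeMonoid c ℓ) where
  open CommutativeMonoid M
  open Sum M
  open SetoidReasoning setoid

  sum-single : ∀ {n} (t : Vector Carrier n) i → (∀ j → j ≢ i → t j ≈ ε) → sum t ≈ t i
  sum-single {suc n} t i t≈ε = begin
    sum t                        ≈⟨ sum-remove {i = i} t ⟩
    t i ∙ sum (λ j → t (punchIn i j))
      ≈⟨ ∙-congˡ (sum-cong-≋ (λ j → t≈ε _ (punchInᵢ≢i i j))) ⟩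
    t i ∙ sum {n} (λ _ → ε)      ≈⟨ ∙-congˡ (sum-replicate-zero n) ⟩
    t i ∙ ε                      ≈⟨ identityʳ _ ⟩
    t i                          ∎

  ∑-last : ∀ n (f : ℕ → Carrier) → ∑[ i < suc n ] f (toℕ i) ≈ ∑[ i < n ] f (toℕ i) ∙ f n
  ∑-last zero    f = comm _ _
  ∑-last (suc n) f = trans (∙-congˡ (∑-last n (f ∘ suc))) (sym (assoc _ _ _))

  ∑-length : ∀ {n n′} (f : ℕ → Carrier) → n ≡ n′ → ∑[ i < n ] f (toℕ i) ≈ ∑[ i < n′ ] f (toℕ i)
  ∑-length f n≡n′ = reflexive (≡.cong (λ n → ∑[ i < n ] f (toℕ i)) n≡n′)

  -- Splits the trace into conjugates of even and odd index. The length is odd, so there is one more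
  -- even index than odd ones; the induction peels off two terms at a time.
  ∑-even-odd : ∀ h (f : ℕ → Carrier) → ∑[ i < suc (2 ℕ.* h) ] f (toℕ i) ≈
               ∑[ i < suc h ] f (2 ℕ.* toℕ i) ∙ ∑[ i < h ] f (suc (2 ℕ.* toℕ i))
  ∑-even-odd zero    f = sym (identityʳ _)
  ∑-even-odd (suc h) f = begin
    ∑[ i < suc (2 ℕ.* suc h) ] f (toℕ i)  ≈⟨ ∑-length f (≡.cong suc (ℕ.*-suc 2 h)) ⟩
    f 0 ∙ (f 1 ∙ ∑[ i < suc (2 ℕ.* h) ] f (2 ℕ.+ toℕ i))
      ≈⟨ ∙-congˡ (∙-congˡ (∑-even-odd h (f ∘ (2 ℕ.+_)))) ⟩
    f 0 ∙ (f 1 ∙ (∑[ i < suc h ] f (2 ℕ.+ 2 ℕ.* toℕ i) ∙ ∑[ i < h ] f (3 ℕ.+ 2 ℕ.* toℕ i)))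
      ≈⟨ ∙-congˡ (∙-congˡ (∙-cong
           (sum-cong-≋ {suc h} (λ i → reflexive (≡.cong f (ℕ.*-suc 2 (toℕ i)))))
           (sum-cong-≋ {h} (λ i → reflexive (≡.cong (f ∘ suc) (ℕ.*-suc 2 (toℕ i))))))) ⟨
    f 0 ∙ (f 1 ∙ (evens ∙ odds))
      ≈⟨ solve 4 (λ a b c d → a ⊕ (b ⊕ (c ⊕ d)) ⊜ (a ⊕ c) ⊕ (b ⊕ d)) refl (f 0) (f 1) evens odds ⟩
    (f 0 ∙ evens) ∙ (f 1 ∙ odds) ∎
    where
    open CommutativeMonoidSolver M
    evens = ∑[ i < suc h ] f (2 ℕ.* suc (toℕ i))
    odds  = ∑[ i < h ] f (suc (2 ℕ.* suc (toℕ i)))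

-- Finite fields: inverses, counting, Fermat's identity and the characteristic.

module FiniteFieldProperties
  {c ℓ₁ ℓ₂ : Level} {N : ℕ} (K : FiniteField c ℓ₁ ℓ₂ N) where

  open FiniteField K hiding (zero)
  open HeytingCommutativeRing heytingCommutativeRing using (#⇒invertible; #-irrefl)
  open import Algebra.Apartness.Properties.HeytingCommutativeRing heytingCommutativeRing
    using (1#0)
  open RingProperties ring using (-0#≈0#; +-cancelˡ)
  open SetoidReasoning setoid

  private
    module ∏ = Sum *-commutativeMonoid
    module ∑ = Sum +-commutativeMonoid

  index : Carrier → Fin N
  index = Inverse.from enumeration

  index-cong : ∀ {x y} → x ≈ y → index x ≡ index y
  index-cong = Inverse.from-cong enumeration

  element-index : ∀ x → element (index x) ≈ x
  element-index _ = Inverse.inverseˡ enumeration ≡.refl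

  index-element : ∀ i → index (element i) ≡ i
  index-element _ = Inverse.inverseʳ enumeration refl

  element-injective : Injective _≡_ _≈_ element
  element-injective {i} {j} eq =
    ≡.trans (≡.sym (index-element i)) (≡.trans (index-cong eq) (index-element j))

  1≉0 : ¬ 1# ≈ 0#
  1≉0 1≈0 = #-irrefl 1≈0 1#0

  #0⇒invertible : ∀ {x} → x # 0# → ∃[ y ] x * y ≈ 1#
  #0⇒invertible {x} x#0 with y , _ , [x-0]y≈1 ← #⇒invertible x#0 = y , (begin
    x * y           ≈⟨ *-congʳ (+-identityʳ x) ⟨
    (x + 0#) * y    ≈⟨ *-congʳ (+-congˡ -0#≈0#) ⟨
    (x - 0#) * y    ≈⟨ [x-0]y≈1 ⟩
    1#              ∎)

  -- The field axioms provide inverses only for elements apart from 0. If the finite search finds no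
  -- inverse, `x` cannot be apart from 0, and tightness makes it equal to 0.
  ≉0⇒invertible : ∀ {x} → ¬ x ≈ 0# → ∃[ y ] x * y ≈ 1#
  ≉0⇒invertible {x} x≉0 with any? (λ i → x * element i ≟ 1#)
  ... | yes (i , xe≈1) = element i , xe≈1
  ... | no none = contradiction
    (proj₁ (HeytingField.tight heytingField x 0#) λ x#0 →
      let y , xy≈1 = #0⇒invertible x#0 in
      none (index y , trans (*-congˡ (element-index y)) xy≈1))
    x≉0

  *-cancelˡ : ∀ {x} y z → ¬ x ≈ 0# → x * y ≈ x * z → y ≈ z
  *-cancelˡ {x} y z x≉0 xy≈xz with x′ , xx′≈1 ← ≉0⇒invertible x≉0 = begin
    y             ≈⟨ strip y ⟨
    x′ * (x * y)  ≈⟨ *-congˡ xy≈xz ⟩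
    x′ * (x * z)  ≈⟨ strip z ⟩
    z             ∎
    where
    strip : ∀ u → x′ * (x * u) ≈ u
    strip u = begin
      x′ * (x * u)  ≈⟨ *-assoc x′ x u ⟨
      x′ * x * u    ≈⟨ *-congʳ (trans (*-comm x′ x) xx′≈1) ⟩
      1# * u        ≈⟨ *-identityˡ u ⟩
      u             ∎

  x*y≈0⇒y≈0 : ∀ {x y} → ¬ x ≈ 0# → x * y ≈ 0# → y ≈ 0#
  x*y≈0⇒y≈0 {x} {y} x≉0 xy≈0 = *-cancelˡ y 0# x≉0 (trans xy≈0 (sym (zeroʳ x)))

  ∏≉0 : ∀ {n} (t : Vector Carrier n) → (∀ i → ¬ t i ≈ 0#) → ¬ ∏.sum t ≈ 0#
  ∏≉0 {zero}  t t≉0 = 1≉0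
  ∏≉0 {suc n} t t≉0 = ∏≉0 (t ∘ suc) (t≉0 ∘ suc) ∘ x*y≈0⇒y≈0 (t≉0 zero)

  -- The second hypothesis accounts for the convention 1/0 = 0: when `y` vanishes the quotient is 0,
  -- so `z` must vanish too.
  /-unique : ∀ {x y z} → x ≈ y * z → (y ≈ 0# → z ≈ 0#) → x / y ≈ z
  /-unique {x} {y} {z} x≈yz y≈0⇒z≈0 with any? (λ i → y * element i ≟ 1#)
  ... | yes (i , ye≈1) = begin
    x * element i        ≈⟨ *-congʳ (trans x≈yz (*-comm y z)) ⟩
    z * y * element i    ≈⟨ *-assoc z y _ ⟩
    z * (y * element i)  ≈⟨ *-congˡ ye≈1 ⟩
    z * 1#               ≈⟨ *-identityʳ z ⟩
    z                    ∎
  ... | no none with y ≟ 0#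
  ...   | yes y≈0 = trans (zeroʳ x) (sym (y≈0⇒z≈0 y≈0))
  ...   | no y≉0 with y′ , yy′≈1 ← ≉0⇒invertible y≉0 =
    contradiction (index y′ , trans (*-congˡ (element-index y′)) yy′≈1) none

  -- Pigeonhole: a value `y` missed by `f` could be adjoined to its values, giving an injection from
  -- `Fin (suc N)` to `Fin N`.
  injective⇒strictlySurjective : ∀ {f} → Injective _≈_ _≈_ f → ∀ y → ∃[ x ] f x ≈ y
  injective⇒strictlySurjective {f} f-inj y with any? (λ i → f (element i) ≟ y)
  ... | yes (i , fe≈y) = element i , fe≈y
  ... | no none = contradiction (injective⇒≤ extended-injective) ℕ.1+n≰n
    where
    extended : Fin (suc N) → Fin N
    extended zero    = index y
    extended (suc i) = index (f (element i))

    index-injective : ∀ {u v} → index u ≡ index v → u ≈ v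
    index-injective {u} {v} eq = begin
      u                  ≈⟨ element-index u ⟨
      element (index u)  ≡⟨ ≡.cong element eq ⟩
      element (index v)  ≈⟨ element-index v ⟩
      v                  ∎

    extended-injective : Injective _≡_ _≡_ extended
    extended-injective {zero}  {zero}  _  = ≡.refl
    extended-injective {zero}  {suc j} eq = contradiction (j , sym (index-injective eq)) none
    extended-injective {suc i} {zero}  eq = contradiction (i , index-injective eq) none
    extended-injective {suc i} {suc j} eq =
      ≡.cong suc (element-injective (f-inj (index-injective eq)))

  -- Turns a bijection of the field into a permutation of the indices, so that sums and products
  -- over all elements are invariant under it.
  reindexing : ∀ {f g} → Congruent _≈_ _≈_ f → Congruent _≈_ _≈_ g →
               (∀ x → f (g x) ≈ x) → (∀ x → g (f x) ≈ x) →
               ∃[ π ] ∀ i → element (_⟨$⟩ʳ_ {N} {N} π i) ≈ f (element i)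
  reindexing {f} {g} f-cong g-cong f∘g g∘f =
    permutation (index ∘ f ∘ element) (index ∘ g ∘ element)
      (λ i → ≡.trans (index-cong (trans (f-cong (element-index _)) (f∘g _))) (index-element i))
      (λ i → ≡.trans (index-cong (trans (g-cong (element-index _)) (g∘f _))) (index-element i))
    , λ i → element-index _

  private
    ifZero : Carrier → Carrier → Carrier → Carrier
    ifZero e u v with e ≟ 0#
    ... | yes _ = u
    ... | no  _ = v

    ifZero-yes : ∀ {e u v} → e ≈ 0# → ifZero e u v ≈ u
    ifZero-yes {e} e≈0 with e ≟ 0#
    ... | yes _  = refl
    ... | no e≉0 = contradiction e≈0 e≉0

    ifZero-no : ∀ {e u v} → ¬ e ≈ 0# → ifZero e u v ≈ v
    ifZero-no {e} e≉0 with e ≟ 0#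
    ... | yes e≈0 = contradiction e≈0 e≉0
    ... | no _    = refl

    nonzeroPart : Carrier → Carrier
    nonzeroPart e = ifZero e 1# e

    nonzeroPart-cong : Congruent _≈_ _≈_ nonzeroPart
    nonzeroPart-cong {x} {y} x≈y with x ≟ 0# | y ≟ 0#
    ... | yes _   | yes _   = refl
    ... | yes x≈0 | no y≉0  = contradiction (trans (sym x≈y) x≈0) y≉0
    ... | no x≉0  | yes y≈0 = contradiction (trans x≈y y≈0) x≉0
    ... | no _    | no _    = x≈y

    nonzeroPart≉0 : ∀ e → ¬ nonzeroPart e ≈ 0#
    nonzeroPart≉0 e with e ≟ 0#
    ... | yes _  = 1≉0
    ... | no e≉0 = e≉0

  -- Multiplication by x ≉ 0 permutes the nonzero elements; the element 0, which enters the
  -- product over the enumeration as 1, accounts for the extra factor x.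
  x^N≈x : ∀ x → x ^ N ≈ x
  x^N≈x x with x ≟ 0#
  ... | yes x≈0 = trans (0^N≈0 (index 0#)) (sym x≈0)
    where
    -- An inhabitant of `Fin n` rules out the exponent 0, for which the power would be 1.
    0^N≈0 : ∀ {n} → Fin n → x ^ n ≈ 0#
    0^N≈0 {suc n} _ = trans (*-congʳ x≈0) (zeroˡ _)
  ... | no x≉0 with x′ , xx′≈1 ← ≉0⇒invertible x≉0 =
    *-cancelˡ _ _ (∏≉0 (nonzeroPart ∘ element) (nonzeroPart≉0 ∘ element)) (begin
      Π * x ^ N                                            ≈⟨ *-comm Π _ ⟩
      x ^ N * Π                                            ≈⟨ *-congʳ (∏.sum-replicate N) ⟨
      ∏.sum {N} (λ _ → x) * Π                              ≈⟨ ∏.∑-distrib-+ (λ _ → x) (nonzeroPart ∘ element) ⟨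
      ∏.sum {N} (λ i → x * nonzeroPart (element i))        ≈⟨ ∏.sum-cong-≋ {N} (λ i → split (element i)) ⟩
      ∏.sum {N} (λ i → correction (element i) * nonzeroPart (x * element i))
        ≈⟨ ∏.∑-distrib-+ (correction ∘ element) (λ i → nonzeroPart (x * element i)) ⟩
      ∏.sum (correction ∘ element) * ∏.sum (λ i → nonzeroPart (x * element i))
        ≈⟨ *-cong ∏correction ∏shifted ⟩
      x * Π                                                ≈⟨ *-comm x Π ⟩
      Π * x                                                ∎)
    where
    Π = ∏.sum (nonzeroPart ∘ element)

    correction : Carrier → Carrier
    correction e = ifZero e x 1#

    split : ∀ e → x * nonzeroPart e ≈ correction e * nonzeroPart (x * e)
    split e with e ≟ 0#
    ... | yes e≈0 = *-congˡ (sym (ifZero-yes (trans (*-congˡ e≈0) (zeroʳ x))))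
    ... | no e≉0  = trans (sym (ifZero-no (e≉0 ∘ x*y≈0⇒y≈0 x≉0))) (sym (*-identityˡ _))

    ∏correction : ∏.sum (correction ∘ element) ≈ x
    ∏correction = trans
      (sum-single *-commutativeMonoid (correction ∘ element) (index 0#)
        (λ j j≢0 → ifZero-no (λ ej≈0 → j≢0
          (≡.trans (≡.sym (index-element j)) (index-cong ej≈0)))))
      (ifZero-yes (element-index 0#))

    undo : ∀ {u v} → u * v ≈ 1# → ∀ e → u * (v * e) ≈ e
    undo {u} {v} uv≈1 e =
      trans (sym (*-assoc u v e)) (trans (*-congʳ uv≈1) (*-identityˡ e))

    ∏shifted : ∏.sum (λ i → nonzeroPart (x * element i)) ≈ Π
    ∏shifted =
      let π , π-spec = reindexing {x *_} {x′ *_} *-congˡ *-congˡ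
                         (undo xx′≈1) (undo (trans (*-comm x′ x) xx′≈1))
      in sym (trans (∏.sum-permute (nonzeroPart ∘ element) π)
                    (∏.sum-cong-≋ (λ i → nonzeroPart-cong (π-spec i))))

  open Mult semiring using () renaming (_×_ to _·_)

  -- Translation by 1 permutes the field, so it does not change the sum of all elements.
  N·1≈0 : N · 1# ≈ 0#
  N·1≈0 = +-cancelˡ Σe _ _ (begin
    Σe + N · 1#                       ≈⟨ +-congˡ (∑.sum-replicate N) ⟨
    Σe + sum {N} (λ _ → 1#)           ≈⟨ ∑.∑-distrib-+ element (λ _ → 1#) ⟨
    sum {N} (λ i → element i + 1#)    ≈⟨ ∑.sum-cong-≋ {N} (proj₂ translation) ⟨
    sum (element ∘ (π ⟨$⟩ʳ_))         ≈⟨ ∑.sum-permute element π ⟨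
    Σe                                ≈⟨ +-identityʳ Σe ⟨
    Σe + 0#                           ∎)
    where
    Σe = sum element
    pred-suc : ∀ x → x - 1# + 1# ≈ x
    pred-suc x = trans (+-assoc _ _ _) (trans (+-congˡ (-‿inverseˡ 1#)) (+-identityʳ x))
    suc-pred : ∀ x → x + 1# - 1# ≈ x
    suc-pred x = trans (+-assoc _ _ _) (trans (+-congˡ (-‿inverseʳ 1#)) (+-identityʳ x))
    translation = reindexing {_+ 1#} {_- 1#} +-congʳ +-congʳ pred-suc suc-pred
    π = proj₁ translation

  -- `N · 1#` is a power of `1# + 1#`. If that element were nonzero, so would be its powers,
  -- contradicting `N·1≈0`.
  characteristicTwo : ∀ e → N ≡ 2 ℕ.^ e → 1# + 1# ≈ 0#
  characteristicTwo e N≡2^e with (1# + 1#) ≟ 0#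
  ... | yes 1+1≈0 = 1+1≈0
  ... | no  1+1≉0 = contradiction
    (trans (reflexive (≡.cong (_· 1#) (≡.sym N≡2^e))) N·1≈0) (2^e≉0 e)
    where
    2^e≉0 : ∀ e → ¬ (2 ℕ.^ e) · 1# ≈ 0#
    2^e≉0 zero    1·1≈0 = 1≉0 (trans (sym (+-identityʳ 1#)) 1·1≈0)
    2^e≉0 (suc e) eq = 2^e≉0 e (x*y≈0⇒y≈0
      (λ 2·1≈0 → 1+1≉0 (trans (+-congˡ (sym (+-identityʳ 1#))) 2·1≈0))
      (trans (sym (Mult.×1-homo-* semiring 2 (2 ℕ.^ e))) eq))

  linearized-cong : ∀ {m} (l : Vector Carrier m) → Congruent _≈_ _≈_ (linearized l)
  linearized-cong {m} l x≈y = Sum.sum-cong-≋ +-commutativeMonoid {m} λ i →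
    *-congˡ {l i} (Exp.^-congˡ semiring (2 ℕ.^ toℕ i) x≈y)

-- Monic polynomials and the number of their roots.

module MonicPolynomials
  {c ℓ₁ ℓ₂ : Level} {N : ℕ} (K : FiniteField c ℓ₁ ℓ₂ N) where

  open FiniteField K hiding (zero)
  open FiniteFieldProperties K
  open RingProperties ring using ([y-z]x≈yx-zx)
  open GroupProperties +-group using (x∙y⁻¹≈ε⇒x≈y; x≈y⇒x∙y⁻¹≈ε)
  open NaturalSolver commutativeSemiring
  open SetoidReasoning setoid

  -- The polynomial with lower coefficients p and an implicit leading coefficient 1.
  evalMonic : ∀ {d} → Vec Carrier d → Carrier → Carrier
  evalMonic []      x = 1#
  evalMonic (c ∷ p) x = c + x * evalMonic p x

  -- Synthetic division by X - r: by Horner's scheme each coefficient is the value at `r` of a tail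
  -- of the dividend.
  quotient : ∀ {d} → Vec Carrier (suc d) → Carrier → Vec Carrier d
  quotient {zero}  p       r = []
  quotient {suc d} (c ∷ p) r = evalMonic p r ∷ quotient p r

  -- This is p(x) - p(r) = (x - r) Q(x), with the negative terms moved across so that a semiring
  -- solver applies.
  evalMonic-quotient : ∀ {d} (p : Vec Carrier (suc d)) r x →
    evalMonic p x + r * evalMonic (quotient p r) x ≈ evalMonic p r + x * evalMonic (quotient p r) x
  evalMonic-quotient {zero} (c ∷ []) r x =
    solve 3 (λ c r x → c :+ x :* con 1 :+ r :* con 1 := c :+ r :* con 1 :+ x :* con 1) refl c r x
  evalMonic-quotient {suc d} (c ∷ p) r x = begin
    c + x * px + r * (pr + x * Q)
      ≈⟨ solve 6 (λ c r x px pr Q → c :+ x :* px :+ r :* (pr :+ x :* Q)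
                                  := c :+ r :* pr :+ x :* (px :+ r :* Q)) refl c r x px pr Q ⟩
    c + r * pr + x * (px + r * Q)
      ≈⟨ +-congˡ (*-congˡ (evalMonic-quotient p r x)) ⟩
    c + r * pr + x * (pr + x * Q) ∎
    where
    px = evalMonic p x
    pr = evalMonic p r
    Q  = evalMonic (quotient p r) x

  -- Induction on the degree: dividing by X - r₀ leaves a monic quotient that vanishes at all the
  -- other roots, since r - r₀ is nonzero there.
  monic-roots : ∀ {d} (p : Vec Carrier d) (r : Vector Carrier (suc d)) →
                Injective _≡_ _≈_ r → ¬ (∀ i → evalMonic p (r i) ≈ 0#)
  monic-roots {zero}  []  r r-inj root = 1≉0 (root zero)
  monic-roots {suc d} p   r r-inj root = monic-roots (quotient p r₀) (r ∘ suc)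
    (suc-injective ∘ r-inj) λ i → x*y≈0⇒y≈0
      (λ eq → contradiction (r-inj (x∙y⁻¹≈ε⇒x≈y _ _ eq)) λ ())
      (begin
        (r (suc i) - r₀) * Q i              ≈⟨ [y-z]x≈yx-zx (Q i) (r (suc i)) r₀ ⟩
        r (suc i) * Q i - r₀ * Q i          ≈⟨ x≈y⇒x∙y⁻¹≈ε (step i) ⟩
        0#                                  ∎)
    where
    r₀ = r zero
    Q : Fin (suc d) → Carrier
    Q i = evalMonic (quotient p r₀) (r (suc i))
    step : ∀ i → r (suc i) * Q i ≈ r₀ * Q i
    step i = begin
      r (suc i) * Q i                         ≈⟨ +-identityˡ _ ⟨
      0# + r (suc i) * Q i                    ≈⟨ +-congʳ (root zero) ⟨
      evalMonic p r₀ + r (suc i) * Q i        ≈⟨ evalMonic-quotient p r₀ (r (suc i)) ⟨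
      evalMonic p (r (suc i)) + r₀ * Q i      ≈⟨ +-congʳ (root (suc i)) ⟩
      0# + r₀ * Q i                           ≈⟨ +-identityˡ _ ⟩
      r₀ * Q i                                ∎

  evalMonic-monomial : ∀ d x → evalMonic (Vec.replicate d 0#) x ≈ x ^ d
  evalMonic-monomial zero    x = refl
  evalMonic-monomial (suc d) x = trans (+-identityˡ _) (*-congˡ (evalMonic-monomial d x))

  -- The `r i` already are q distinct roots of X^q - X; a fixed point outside them would be one root
  -- too many.
  fixed-by-power : ∀ {q} → 2 ℕ.≤ q → (r : Vector Carrier q) → Injective _≡_ _≈_ r →
                   (∀ i → r i ^ q ≈ r i) → ∀ {x} → x ^ q ≈ x → ∃[ i ] r i ≈ x
  fixed-by-power {suc (suc d)} (s≤s (s≤s _)) r r-inj r-fixed {x} x-fixed with any? (λ i → r i ≟ x)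
  ... | yes found = found
  ... | no none = contradiction root (monic-roots X^[2+d]-X r′ r′-inj)
    where
    -- With q = 2 + d the term -X lies strictly below the implicit leading term.
    X^[2+d]-X : Vec Carrier (2 ℕ.+ d)
    X^[2+d]-X = 0# ∷ - 1# ∷ Vec.replicate d 0#

    r′ : Vector Carrier (3 ℕ.+ d)
    r′ zero    = x
    r′ (suc i) = r i

    r′-inj : Injective _≡_ _≈_ r′
    r′-inj {zero}  {zero}  _  = ≡.refl
    r′-inj {zero}  {suc j} eq = contradiction (j , sym eq) none
    r′-inj {suc i} {zero}  eq = contradiction (i , eq) none
    r′-inj {suc i} {suc j} eq = ≡.cong suc (r-inj eq)

    fixed⇒root : ∀ {y} → y ^ (2 ℕ.+ d) ≈ y → evalMonic X^[2+d]-X y ≈ 0#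
    fixed⇒root {y} y-fixed = begin
      0# + y * (- 1# + y * evalMonic (Vec.replicate d 0#) y)
        ≈⟨ trans (+-identityˡ _) (*-congˡ (+-congˡ (*-congˡ (evalMonic-monomial d y)))) ⟩
      y * (- 1# + y * y ^ d)           ≈⟨ distribˡ _ _ _ ⟩
      y * - 1# + y ^ (2 ℕ.+ d)         ≈⟨ +-congˡ (trans y-fixed (sym (*-identityʳ y))) ⟩
      y * - 1# + y * 1#                ≈⟨ distribˡ _ _ _ ⟨
      y * (- 1# + 1#)                  ≈⟨ *-congˡ (-‿inverseˡ 1#) ⟩
      y * 0#                           ≈⟨ zeroʳ y ⟩
      0#                               ∎

    root : ∀ i → evalMonic X^[2+d]-X (r′ i) ≈ 0#
    root zero    = fixed⇒root x-fixed
    root (suc i) = fixed⇒root (r-fixed i)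

-- Iterated squaring in characteristic two.

HasCharacteristicTwo : ∀ {c ℓ} → CommutativeRing c ℓ → Set ℓ
HasCharacteristicTwo R = 1# + 1# ≈ 0#
  where open CommutativeRing R

module CharacteristicTwo
  {c ℓ} (R : CommutativeRing c ℓ)
  (1+1≈0 : HasCharacteristicTwo R) where

  open CommutativeRing R
  open SetoidReasoning setoid
  open Exp semiring
  open CommutativeExp commutativeSemiring using (^-distrib-*)
  open Sum +-commutativeMonoid using (sum; sum-syntax; sum-cong-≋)

  -- A ring solver with coefficients in 𝔽₂, i.e. one that knows x + x ≈ 0#.
  private
    coefficients : CommutativeRing.rawRing xor-∧-commutativeRing
                   -Raw-AlmostCommutative⟶ fromCommutativeRing R
    coefficients = record
      { ⟦_⟧    = ⟦_⟧
      ; +-homo = λ { false _    → sym (+-identityˡ _)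
                   ; true false → sym (+-identityʳ _)
                   ; true true  → sym 1+1≈0 }
      ; *-homo = λ { false _ → sym (zeroˡ _) ; true _ → sym (*-identityˡ _) }
      ; -‿homo = λ { false → sym -0#≈0# ; true → +-inverseʳ-unique 1# 1# 1+1≈0 }
      ; 0-homo = refl
      ; 1-homo = refl
      }
      where
      open RingProperties ring using (-0#≈0#; +-inverseʳ-unique)
      ⟦_⟧ : Bool → Carrier
      ⟦ false ⟧ = 0#
      ⟦ true  ⟧ = 1#

  module Solver = Algebra.Solver.Ring _ _ coefficients
    (λ b b′ → Maybe.map (reflexive ∘ ≡.cong (_-Raw-AlmostCommutative⟶_.⟦_⟧ coefficients))
                     (dec⇒weaklyDec _≟ᵇ_ b b′))

  open Solver

  x+x≈0 : ∀ x → x + x ≈ 0#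
  x+x≈0 = solve 1 (λ x → x :+ x := con false) refl

  frobenius : ℕ → Carrier → Carrier
  frobenius e x = x ^ (2 ℕ.^ e)

  frobenius-cong : ∀ e → Congruent _≈_ _≈_ (frobenius e)
  frobenius-cong e = ^-congˡ (2 ℕ.^ e)

  frobenius-congʳ : ∀ x {d e} → d ≡ e → frobenius d x ≈ frobenius e x
  frobenius-congʳ x d≡e = ^-congʳ x (≡.cong (2 ℕ.^_) d≡e)

  frobenius-zero : ∀ x → frobenius 0 x ≈ x
  frobenius-zero = *-identityʳ

  frobenius-suc : ∀ e x → frobenius (suc e) x ≈ frobenius e x * frobenius e x
  frobenius-suc e x = trans (^-homo-* x (2 ℕ.^ e) _)
    (*-congˡ (^-congʳ x (ℕ.+-identityʳ (2 ℕ.^ e))))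

  frobenius-frobenius : ∀ d e x → frobenius d (frobenius e x) ≈ frobenius (e ℕ.+ d) x
  frobenius-frobenius d e x = trans (^-assocʳ x (2 ℕ.^ e) (2 ℕ.^ d))
    (^-congʳ x (≡.sym (ℕ.^-distribˡ-+-* 2 e d)))

  -- Induction on `e`: in each squaring the cross term occurs twice and vanishes.
  frobenius-+ : ∀ e x y → frobenius e (x + y) ≈ frobenius e x + frobenius e y
  frobenius-+ zero    x y =
    solve 2 (λ x y → (x :+ y) :* con true := x :* con true :+ y :* con true) refl x y
  frobenius-+ (suc e) x y = begin
    frobenius (suc e) (x + y)         ≈⟨ frobenius-suc e (x + y) ⟩
    frobenius e (x + y) * frobenius e (x + y)
      ≈⟨ *-cong (frobenius-+ e x y) (frobenius-+ e x y) ⟩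
    (u + v) * (u + v)
      ≈⟨ solve 2 (λ u v → (u :+ v) :* (u :+ v) := u :* u :+ v :* v) refl u v ⟩
    u * u + v * v                     ≈⟨ +-cong (frobenius-suc e x) (frobenius-suc e y) ⟨
    frobenius (suc e) x + frobenius (suc e) y  ∎
    where
    u = frobenius e x
    v = frobenius e y

  frobenius-* : ∀ e x y → frobenius e (x * y) ≈ frobenius e x * frobenius e y
  frobenius-* e x y = ^-distrib-* x y (2 ℕ.^ e)

  frobenius-0# : ∀ e → frobenius e 0# ≈ 0#
  frobenius-0# zero    = zeroˡ _
  frobenius-0# (suc e) = trans (frobenius-suc e 0#) (trans (*-congʳ (frobenius-0# e)) (zeroˡ _))

  frobenius-sum : ∀ e {n} (t : Vector Carrier n) → frobenius e (sum t) ≈ ∑[ i < n ] frobenius e (t i)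
  frobenius-sum e {zero}  t = frobenius-0# e
  frobenius-sum e {suc n} t = trans (frobenius-+ e _ _) (+-congˡ (frobenius-sum e (t ∘ suc)))

  sum-square : ∀ {n} (t : Vector Carrier n) → ∑[ i < n ] (t i * t i) ≈ sum t * sum t
  sum-square t = begin
    ∑[ i < _ ] (t i * t i)       ≈⟨ sum-cong-≋ (square ∘ t) ⟨
    ∑[ i < _ ] frobenius 1 (t i) ≈⟨ frobenius-sum 1 t ⟨
    frobenius 1 (sum t)          ≈⟨ square (sum t) ⟩
    sum t * sum t                ∎
    where
    square : ∀ x → frobenius 1 x ≈ x * x
    square x = *-congˡ (*-identityʳ x)

  -- In characteristic 2 a sum of neighbours is also their difference, so the inner terms cancel.
  ∑-telescope : ∀ n (u : ℕ → Carrier) → ∑[ i < n ] (u (toℕ i) + u (suc (toℕ i))) ≈ u 0 + u n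
  ∑-telescope zero    u = sym (x+x≈0 (u 0))
  ∑-telescope (suc n) u = trans (+-congˡ (∑-telescope n (u ∘ suc)))
    (solve 3 (λ x y z → x :+ y :+ (y :+ z) := x :+ z) refl (u 0) (u 1) (u (suc n)))

  frobenius-fixed : ∀ {e x} → frobenius e x ≈ x → ∀ i → frobenius (e ℕ.* i) x ≈ x
  frobenius-fixed {e} {x} fixed zero    = trans (frobenius-congʳ x (ℕ.*-zeroʳ e)) (frobenius-zero x)
  frobenius-fixed {e} {x} fixed (suc i) = begin
    frobenius (e ℕ.* suc i) x              ≈⟨ frobenius-congʳ x (ℕ.*-suc e i) ⟩
    frobenius (e ℕ.+ e ℕ.* i) x            ≈⟨ frobenius-frobenius (e ℕ.* i) e x ⟨
    frobenius (e ℕ.* i) (frobenius e x)    ≈⟨ frobenius-cong (e ℕ.* i) fixed ⟩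
    frobenius (e ℕ.* i) x                  ≈⟨ frobenius-fixed {e} {x} fixed i ⟩
    x                                      ∎

-- Transfer along the embedding of the small field.

module FieldEmbedding {c ℓ₁ ℓ₂ c′ ℓ₁′ ℓ₂′ : Level} {M N : ℕ}
  (k : FiniteField c ℓ₁ ℓ₂ M) (K : FiniteField c′ ℓ₁′ ℓ₂′ N)
  (ι : FiniteField.Carrier k → FiniteField.Carrier K) (ι-embedding : IsFieldEmbedding k K ι)
  where

  private
    module k = FiniteField k
    module k′ = FiniteFieldProperties k
  open FiniteField K hiding (zero)
  open FiniteFieldProperties K
  open SetoidReasoning setoid
  open Morphism.IsRingHomomorphism ι-embedding
    renaming (⟦⟧-cong to ι-cong; +-homo to ι-+; *-homo to ι-*
             ; -‿homo to ι--; 0#-homo to ι-0#; 1#-homo to ι-1#)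

  ι-#0⇒≉0 : ∀ {u} → u k.# k.0# → ¬ ι u ≈ 0#
  ι-#0⇒≉0 {u} u#0 ιu≈0 with v , uv≈1 ← k′.#0⇒invertible u#0 = 1≉0 (begin
    1#             ≈⟨ ι-1# ⟨
    ι k.1#         ≈⟨ ι-cong uv≈1 ⟨
    ι (u k.* v)    ≈⟨ ι-* u v ⟩
    ι u * ι v      ≈⟨ *-congʳ ιu≈0 ⟩
    0# * ι v       ≈⟨ zeroˡ _ ⟩
    0#             ∎)

  -- A nonzero difference has an inverse, which `ι` preserves; were the images equal, 1 would be 0
  -- in the large field.
  ι-injective : Injective k._≈_ _≈_ ι
  ι-injective {u} {v} ιu≈ιv with u k.- v k.≟ k.0#
  ... | yes u-v≈0 = GroupProperties.x∙y⁻¹≈ε⇒x≈y k.+-group u v u-v≈0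
  ... | no u-v≉0 with w , [u-v]w≈1 ← k′.≉0⇒invertible u-v≉0 = contradiction (begin
    1#                   ≈⟨ ι-1# ⟨
    ι k.1#               ≈⟨ ι-cong [u-v]w≈1 ⟨
    ι ((u k.- v) k.* w)  ≈⟨ ι-* _ w ⟩
    ι (u k.- v) * ι w    ≈⟨ *-congʳ ι[u-v]≈0 ⟩
    0# * ι w             ≈⟨ zeroˡ _ ⟩
    0#                   ∎) 1≉0
    where
    ι[u-v]≈0 : ι (u k.- v) ≈ 0#
    ι[u-v]≈0 = begin
      ι (u k.- v)        ≈⟨ trans (ι-+ u _) (+-congˡ (ι-- v)) ⟩
      ι u - ι v          ≈⟨ +-congʳ ιu≈ιv ⟩
      ι v - ι v          ≈⟨ -‿inverseʳ (ι v) ⟩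
      0#                 ∎

  ι-^ : ∀ u e → ι (u k.^ e) ≈ ι u ^ e
  ι-^ u zero    = ι-1#
  ι-^ u (suc e) = trans (ι-* u _) (*-congˡ (ι-^ u e))

  ι-eval : ∀ p {u x} → x ≈ ι u → eval (map ι p) x ≈ ι (k.eval p u)
  ι-eval []      x≈ιu = sym ι-0#
  ι-eval (a ∷ p) {u} {x} x≈ιu = sym (begin
    ι (a k.+ u k.* k.eval p u)        ≈⟨ ι-+ a _ ⟩
    ι a + ι (u k.* k.eval p u)        ≈⟨ +-congˡ (ι-* u _) ⟩
    ι a + ι u * ι (k.eval p u)        ≈⟨ +-congˡ (*-cong x≈ιu (ι-eval p x≈ιu)) ⟨
    ι a + x * eval (map ι p) x        ∎)

  ι-sum : ∀ {n} (t : Vector k.Carrier n) → ι (k.sum t) ≈ ∑[ i < n ] ι (t i)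
  ι-sum {zero}  t = ι-0#
  ι-sum {suc n} t = trans (ι-+ _ _) (+-congˡ (ι-sum (t ∘ suc)))

  ι-linearized : ∀ {m} (l : Vector k.Carrier m) u → ι (k.linearized l u) ≈ linearized (ι ∘ l) (ι u)
  ι-linearized {m} l u = trans (ι-sum (λ i → l i k.* u k.^ (2 ℕ.^ toℕ i)))
    (Sum.sum-cong-≋ +-commutativeMonoid {m} λ i → trans (ι-* (l i) _) (*-congˡ (ι-^ u (2 ℕ.^ toℕ i))))

-- The subfield of q elements and the trace.

module InverseFormula
  {c ℓ₁ ℓ₂ c′ ℓ₁′ ℓ₂′ : Level} (m′ n : ℕ) (n≡1+2h : n ≡ suc (2 ℕ.* ((n ℕ.∸ 1) ℕ./ 2)))
  (k : FiniteField c ℓ₁ ℓ₂ (2 ℕ.^ suc m′)) (K : FiniteField c′ ℓ₁′ ℓ₂′ ((2 ℕ.^ suc m′) ℕ.^ n))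
  (ι : FiniteField.Carrier k → FiniteField.Carrier K) (ι-embedding : IsFieldEmbedding k K ι)
  where

  private
    m q h : ℕ
    m = suc m′
    q = 2 ℕ.^ m
    h = (n ℕ.∸ 1) ℕ./ 2

    module k = FiniteField k
    module k′ = FiniteFieldProperties k
  open FiniteField K hiding (zero)
  open FiniteFieldProperties K
  open FieldEmbedding k K ι ι-embedding
  open Inversion m n k K ι
  open CharacteristicTwo commutativeRing (characteristicTwo (m ℕ.* n) (ℕ.^-*-assoc 2 m n))
  open Solver
  open Sum +-commutativeMonoid using (sum-cong-≋; ∑-distrib-+)
  open SemiringSum semiring using (*-distribˡ-sum)
  open Exp semiring using (^-congˡ; ^-congʳ; ^-homo-*)
  open Morphism.IsRingHomomorphism ι-embedding
    renaming (⟦⟧-cong to ι-cong; +-homo to ι-+; *-homo to ι-*)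
  open RingProperties ring using (+-cancelʳ)
  open SetoidReasoning setoid

  2≤q : 2 ℕ.≤ q
  2≤q = ℕ.^-monoʳ-≤ 2 {1} {m} (s≤s z≤n)

  x^qⁱ≈frobenius : ∀ x i → x ^ (q ℕ.^ i) ≈ frobenius (m ℕ.* i) x
  x^qⁱ≈frobenius x i = ^-congʳ x (ℕ.^-*-assoc 2 m i)

  frobenius-mn : ∀ x → frobenius (m ℕ.* n) x ≈ x
  frobenius-mn x = trans (sym (x^qⁱ≈frobenius x n)) (x^N≈x x)

  -- Membership in the copy of 𝔽_q inside the large field, as `ι-fixed` and `fixed⇒ι` show.
  Fixed : Carrier → Set _
  Fixed x = frobenius m x ≈ x

  ι-fixed : ∀ {x u} → x ≈ ι u → Fixed x
  ι-fixed {x} {u} x≈ιu = begin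
    x ^ q        ≈⟨ ^-congˡ q x≈ιu ⟩
    ι u ^ q      ≈⟨ ι-^ u q ⟨
    ι (u k.^ q)  ≈⟨ ι-cong (k′.x^N≈x u) ⟩
    ι u          ≈⟨ x≈ιu ⟨
    x            ∎

  -- The images of the q elements of `k` are q distinct roots of X^q - X, hence all of them.
  fixed⇒ι : ∀ {x} → Fixed x → ∃[ u ] x ≈ ι u
  fixed⇒ι x-fixed =
    let i , ιeᵢ≈x = MonicPolynomials.fixed-by-power K 2≤q (ι ∘ k.element)
                      (k′.element-injective ∘ ι-injective)
                      (λ i → ι-fixed refl) x-fixed
    in k.element i , sym ιeᵢ≈x

  Tr≈∑frobenius : ∀ x → Tr x ≈ ∑[ i < n ] frobenius (m ℕ.* toℕ i) x
  Tr≈∑frobenius x = sum-cong-≋ {n} (λ i → x^qⁱ≈frobenius x (toℕ i))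

  Tr-fixed : ∀ x → Fixed (Tr x)
  -- After adding `x`, both sides are the sum of the conjugates with indices 0 to n: `x` is `σ 0` on
  -- the left and `σ n` on the right.
  Tr-fixed x = +-cancelʳ x _ _ (begin
    frobenius m (Tr x) + x
      ≈⟨ +-congʳ (frobenius-cong m (Tr≈∑frobenius x)) ⟩
    frobenius m (∑[ i < n ] σ (toℕ i)) + x
      ≈⟨ +-congʳ (frobenius-sum m (σ ∘ toℕ {n})) ⟩
    ∑[ i < n ] frobenius m (σ (toℕ i)) + x
      ≈⟨ +-cong (sum-cong-≋ {n} (λ i → frobenius-σ (toℕ i))) (sym σ0≈x) ⟩
    ∑[ i < n ] σ (suc (toℕ i)) + σ 0     ≈⟨ +-comm _ _ ⟩
    ∑[ i < suc n ] σ (toℕ i)             ≈⟨ ∑-last +-commutativeMonoid n σ ⟩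
    ∑[ i < n ] σ (toℕ i) + σ n           ≈⟨ +-cong (sym (Tr≈∑frobenius x)) (frobenius-mn x) ⟩
    Tr x + x                             ∎)
    where
    σ : ℕ → Carrier
    σ i = frobenius (m ℕ.* i) x

    σ0≈x : σ 0 ≈ x
    σ0≈x = trans (frobenius-congʳ x (ℕ.*-zeroʳ m)) (frobenius-zero x)

    frobenius-σ : ∀ i → frobenius m (σ i) ≈ σ (suc i)
    frobenius-σ i = trans (frobenius-frobenius m (m ℕ.* i) x)
      (frobenius-congʳ x (≡.trans (ℕ.+-comm (m ℕ.* i) m) (≡.sym (ℕ.*-suc m i))))

  Tr-cong : Congruent _≈_ _≈_ Tr
  Tr-cong x≈y = sum-cong-≋ {n} (λ i → ^-congˡ (q ℕ.^ toℕ i) x≈y)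

  x*x^[j∸1]≈x^j : ∀ x j → .{{_ : ℕ.NonZero j}} → x * x ^ (j ℕ.∸ 1) ≈ x ^ j
  x*x^[j∸1]≈x^j x (suc j) = refl

  -- The terms of the formula at y = bx + ax², with a and b in 𝔽_q.

  module Preimage
    {a b x y : Carrier} (a-fixed : Fixed a) (a≉0 : ¬ a ≈ 0#) (b-fixed : Fixed b)
    (y≈bx+ax² : y ≈ b * x + a * (x * x))
    where

    T : Carrier
    T = Tr x

    u : ℕ → Carrier
    u i = frobenius (m ℕ.* i) x

    s : ℕ
    s = 2 ℕ.^ m′

    private instance
      s≢0 : ℕ.NonZero s
      s≢0 = ℕ.m^n≢0 2 m′
      q≢0 : ℕ.NonZero q
      q≢0 = ℕ.m^n≢0 2 m

    γ B : Carrier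
    γ = a ^ (s ℕ.∸ 1)
    B = b ^ (q ℕ.∸ 1)

    frobenius-y : ∀ i → frobenius (m ℕ.* i) y ≈ b * u i + a * (u i * u i)
    frobenius-y i = begin
      frobenius e y                                          ≈⟨ frobenius-cong e y≈bx+ax² ⟩
      frobenius e (b * x + a * (x * x))                      ≈⟨ frobenius-+ e _ _ ⟩
      frobenius e (b * x) + frobenius e (a * (x * x))        ≈⟨ +-cong (frobenius-* e b x) (frobenius-* e a _) ⟩
      frobenius e b * u i + frobenius e a * frobenius e (x * x)
        ≈⟨ +-cong (*-congʳ (frobenius-fixed {m} {b} b-fixed i))
                  (*-cong (frobenius-fixed {m} {a} a-fixed i) (frobenius-* e x x)) ⟩
      b * u i + a * (u i * u i)                              ∎
      where e = m ℕ.* i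

    -- The map z ↦ bz + az² is additive and commutes with q-th powers, so the relation between `x`
    -- and `y` passes to sums of conjugates. `f` selects all of them for the trace, the even ones
    -- for `S`.
    ∑y^q : ∀ {r} (f : Fin r → ℕ) → let S = ∑[ i < r ] u (f i) in
           ∑[ i < r ] (y ^ (q ℕ.^ f i)) ≈ b * S + a * (S * S)
    ∑y^q {r} f = begin
      ∑[ i < r ] (y ^ (q ℕ.^ f i))
        ≈⟨ sum-cong-≋ {r} (λ i → trans (x^qⁱ≈frobenius y (f i)) (frobenius-y (f i))) ⟩
      ∑[ i < r ] (b * u (f i) + a * (u (f i) * u (f i)))
        ≈⟨ ∑-distrib-+ (λ i → b * u (f i)) (λ i → a * (u (f i) * u (f i))) ⟩
      ∑[ i < r ] (b * u (f i)) + ∑[ i < r ] (a * (u (f i) * u (f i)))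
        ≈⟨ +-cong (*-distribˡ-sum b (u ∘ f)) (*-distribˡ-sum a (λ i → u (f i) * u (f i))) ⟨
      b * S + a * ∑[ i < r ] (u (f i) * u (f i))
        ≈⟨ +-congˡ (*-congˡ (sum-square (u ∘ f))) ⟩
      b * S + a * (S * S) ∎
      where S = ∑[ i < r ] u (f i)

    Tr-y : Tr y ≈ b * T + a * (T * T)
    Tr-y = trans (∑y^q {n} toℕ) (+-cong (*-congˡ S≈T) (*-congˡ (*-cong S≈T S≈T)))
      where S≈T = sym (Tr≈∑frobenius x)

    -- The square roots of `a` and `b`: one more squaring gives the q-th power, which fixes both.
    α β : Carrier
    α = frobenius m′ a
    β = frobenius m′ b

    -- `a * γ` is `α`, and the square of `α` is `a`; then `a` cancels.
    γα≈1 : γ * α ≈ 1#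
    γα≈1 = *-cancelˡ _ _ a≉0 (begin
      a * (γ * α)    ≈⟨ *-assoc a γ α ⟨
      a * γ * α      ≈⟨ *-congʳ (x*x^[j∸1]≈x^j a s) ⟩
      α * α          ≈⟨ frobenius-suc m′ a ⟨
      frobenius m a  ≈⟨ a-fixed ⟩
      a              ≈⟨ *-identityʳ a ⟨
      a * 1#         ∎)

    -- `β` contains a factor `b`, and `b * B` is `b ^ q`, which is `b`. This treats b = 0 together
    -- with b nonzero, where `B` is 1.
    Bβ≈β : B * β ≈ β
    Bβ≈β = begin
      B * β                       ≈⟨ *-congˡ (x*x^[j∸1]≈x^j b s) ⟨
      B * (b * b ^ (s ℕ.∸ 1))     ≈⟨ solve 3 (λ B b c → B :* (b :* c) := b :* B :* c) refl B b _ ⟩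
      b * B * b ^ (s ℕ.∸ 1)       ≈⟨ *-congʳ (trans (x*x^[j∸1]≈x^j b q) b-fixed) ⟩
      b * b ^ (s ℕ.∸ 1)           ≈⟨ x*x^[j∸1]≈x^j b s ⟩
      β                           ∎

    -- The left side is the square root of the conjugate of `y` with index i + 1. Applying
    -- `frobenius m′` to the quadratic relation of index i turns its squared term into the next
    -- conjugate of `x`.
    root-y : ∀ {e} i → e ≡ m ℕ.* i ℕ.+ m′ → y ^ (2 ℕ.^ e) ≈ β * frobenius m′ (u i) + α * u (suc i)
    root-y {e} i e≡ = begin
      frobenius e y                                     ≈⟨ frobenius-congʳ y e≡ ⟩
      frobenius (m ℕ.* i ℕ.+ m′) y                      ≈⟨ frobenius-frobenius m′ (m ℕ.* i) y ⟨
      frobenius m′ (frobenius (m ℕ.* i) y)              ≈⟨ frobenius-cong m′ (frobenius-y i) ⟩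
      frobenius m′ (b * u i + a * (u i * u i))          ≈⟨ frobenius-+ m′ _ _ ⟩
      frobenius m′ (b * u i) + frobenius m′ (a * (u i * u i))
        ≈⟨ +-cong (frobenius-* m′ b _) (trans (frobenius-* m′ a _) (*-congˡ (frobenius-* m′ _ _))) ⟩
      β * frobenius m′ (u i) + α * (frobenius m′ (u i) * frobenius m′ (u i))
        ≈⟨ +-congˡ (*-congˡ (trans (sym (frobenius-suc m′ (u i))) next)) ⟩
      β * frobenius m′ (u i) + α * u (suc i)            ∎
      where
      next : frobenius m (u i) ≈ u (suc i)
      next = trans (frobenius-frobenius m (m ℕ.* i) x)
        (frobenius-congʳ x (≡.trans (ℕ.+-comm (m ℕ.* i) m) (≡.sym (ℕ.*-suc m i))))

    -- `S` is cut into `P` and its last term `w` because the sum of square roots in the formula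
    -- involves `P`, while its leading term involves `w`.
    P O w S : Carrier
    P = ∑[ i < h ] u (2 ℕ.* toℕ i)
    O = ∑[ i < h ] u (suc (2 ℕ.* toℕ i))
    S = ∑[ i < suc h ] u (2 ℕ.* toℕ i)
    w = u (2 ℕ.* h)

    S≈P+w : S ≈ P + w
    S≈P+w = ∑-last +-commutativeMonoid h (λ i → u (2 ℕ.* i))

    T≈S+O : T ≈ S + O
    T≈S+O = trans (Tr≈∑frobenius x)
      (trans (∑-length +-commutativeMonoid u n≡1+2h) (∑-even-odd +-commutativeMonoid h u))

    first : y ^ (2 ℕ.^ (n ℕ.* m ℕ.∸ 1)) ≈ β * frobenius m′ w + α * x
    -- The index is 2h = n - 1, so the next conjugate is `u n`, which is `x` again.
    first = trans (root-y (2 ℕ.* h) exponent)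
      (+-congˡ (*-congˡ (trans (reflexive (≡.cong u (≡.sym n≡1+2h))) (frobenius-mn x))))
      where
      exponent : n ℕ.* m ℕ.∸ 1 ≡ m ℕ.* (2 ℕ.* h) ℕ.+ m′
      exponent = ≡.trans (≡.cong (λ n → n ℕ.* m ℕ.∸ 1) n≡1+2h)
        (≡.trans (ℕ.+-comm m′ (2 ℕ.* h ℕ.* m)) (≡.cong (ℕ._+ m′) (ℕ.*-comm (2 ℕ.* h) m)))

    second : ∑[ i < h ] (y ^ (2 ℕ.^ ((2 ℕ.* suc (toℕ i) ℕ.∸ 1) ℕ.* m ℕ.∸ 1))) ≈ β * frobenius m′ P + α * O
    second = begin
      ∑[ i < h ] (y ^ (2 ℕ.^ ((2 ℕ.* suc (toℕ i) ℕ.∸ 1) ℕ.* m ℕ.∸ 1)))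
        ≈⟨ sum-cong-≋ {h} (λ i → root-y (2 ℕ.* toℕ i) (exponent (toℕ i))) ⟩
      ∑[ i < h ] (β * frobenius m′ (even i) + α * odd i)
        ≈⟨ ∑-distrib-+ (λ i → β * frobenius m′ (even i)) (λ i → α * odd i) ⟩
      ∑[ i < h ] (β * frobenius m′ (even i)) + ∑[ i < h ] (α * odd i)
        ≈⟨ +-cong (*-distribˡ-sum β (frobenius m′ ∘ even)) (*-distribˡ-sum α odd) ⟨
      β * ∑[ i < h ] frobenius m′ (even i) + α * O
        ≈⟨ +-congʳ (*-congˡ (frobenius-sum m′ even)) ⟨
      β * frobenius m′ P + α * O ∎
      where
      even odd : Fin h → Carrier
      even i = u (2 ℕ.* toℕ i)
      odd  i = u (suc (2 ℕ.* toℕ i))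

      -- The index starts at 0, so k = i + 1 and 2k - 1 = 2i + 1.
      exponent : ∀ i → (2 ℕ.* suc i ℕ.∸ 1) ℕ.* m ℕ.∸ 1 ≡ m ℕ.* (2 ℕ.* i) ℕ.+ m′
      exponent i = ≡.trans (≡.cong (λ j → (j ℕ.∸ 1) ℕ.* m ℕ.∸ 1) (ℕ.*-suc 2 i))
        (≡.trans (ℕ.+-comm m′ (2 ℕ.* i ℕ.* m)) (≡.cong (ℕ._+ m′) (ℕ.*-comm (2 ℕ.* i) m)))

    -- By `∑y^q` the inner sum `E` is bS + aS². Its 2^j-th power has two terms, whose coefficients
    -- merge with the powers of `a` and `b` in front into `U j` and `U (suc j)`.
    third : ∀ {D} → D ≈ b →
      ∑[ j < m′ ] ( a ^ (2 ℕ.^ toℕ j ℕ.∸ 1) * D ^ (q ℕ.∸ 2 ℕ.^ suc (toℕ j))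
                  * (∑[ i < suc h ] (y ^ (q ℕ.^ (2 ℕ.* toℕ i)))) ^ (2 ℕ.^ toℕ j))
      ≈ B * S + γ * β * frobenius m′ S
    third {D} D≈b = begin
      ∑[ j < m′ ] ( a ^ (2 ℕ.^ toℕ j ℕ.∸ 1) * D ^ (q ℕ.∸ 2 ℕ.^ suc (toℕ j)) * E ^ (2 ℕ.^ toℕ j))
        ≈⟨ sum-cong-≋ {m′} (λ j → summand (toℕ j) (ℕ.<⇒≤ (s≤s (toℕ<n j)))) ⟩
      ∑[ j < m′ ] (U (toℕ j) + U (suc (toℕ j)))  ≈⟨ ∑-telescope m′ U ⟩
      U 0 + U m′
        -- At j = 0 the exponents are 0 for `a` and q - 1 for `b`; at j = m - 1 they are s - 1 and q
        -- - s = s.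
        ≈⟨ +-cong (*-cong (*-identityˡ B) (frobenius-zero S))
                  (*-congʳ (*-congˡ (^-congʳ b q∸s≡s))) ⟩
      B * S + γ * β * frobenius m′ S ∎
      where
      E = ∑[ i < suc h ] (y ^ (q ℕ.^ (2 ℕ.* toℕ i)))

      U : ℕ → Carrier
      U j = a ^ (2 ℕ.^ j ℕ.∸ 1) * b ^ (q ℕ.∸ 2 ℕ.^ j) * frobenius j S

      q∸s≡s : q ℕ.∸ s ≡ s
      q∸s≡s = ≡.trans (ℕ.m+n∸m≡n s (s ℕ.+ 0)) (ℕ.+-identityʳ s)

      E≈bS+aS² : E ≈ b * S + a * (S * S)
      E≈bS+aS² = ∑y^q {suc h} (λ i → 2 ℕ.* toℕ i)

      frobenius-E : ∀ j → frobenius j E ≈ frobenius j b * frobenius j S + frobenius j a * frobenius (suc j) S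
      frobenius-E j = begin
        frobenius j E                                            ≈⟨ frobenius-cong j E≈bS+aS² ⟩
        frobenius j (b * S + a * (S * S))                        ≈⟨ frobenius-+ j _ _ ⟩
        frobenius j (b * S) + frobenius j (a * (S * S))          ≈⟨ +-cong (frobenius-* j b S) (frobenius-* j a _) ⟩
        frobenius j b * frobenius j S + frobenius j a * frobenius j (S * S)
          ≈⟨ +-congˡ (*-congˡ (trans (frobenius-* j S S) (sym (frobenius-suc j S)))) ⟩
        frobenius j b * frobenius j S + frobenius j a * frobenius (suc j) S ∎

      a-powers : ∀ j → a ^ (2 ℕ.^ j ℕ.∸ 1) * frobenius j a ≈ a ^ (2 ℕ.^ suc j ℕ.∸ 1)
      a-powers j = trans (sym (^-homo-* a (2 ℕ.^ j ℕ.∸ 1) (2 ℕ.^ j))) (^-congʳ a (≡.trans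
        (≡.sym (ℕ.+-∸-comm (2 ℕ.^ j) (ℕ.m^n>0 2 j)))
        (≡.cong (λ r → 2 ℕ.^ j ℕ.+ r ℕ.∸ 1) (≡.sym (ℕ.+-identityʳ (2 ℕ.^ j))))))

      b-powers : ∀ j → suc j ℕ.≤ m → b ^ (q ℕ.∸ 2 ℕ.^ suc j) * frobenius j b ≈ b ^ (q ℕ.∸ 2 ℕ.^ j)
      b-powers j j<m = trans (sym (^-homo-* b (q ℕ.∸ 2 ℕ.^ suc j) (2 ℕ.^ j)))
        (^-congʳ b (2^m∸2^[1+j]+2^j≡2^m∸2^j j<m))

      summand : ∀ j → suc j ℕ.≤ m →
        a ^ (2 ℕ.^ j ℕ.∸ 1) * D ^ (q ℕ.∸ 2 ℕ.^ suc j) * E ^ (2 ℕ.^ j) ≈ U j + U (suc j)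
      summand j j<m = begin
        aⱼ * D ^ (q ℕ.∸ 2 ℕ.^ suc j) * frobenius j E
          ≈⟨ *-cong (*-congˡ (^-congˡ (q ℕ.∸ 2 ℕ.^ suc j) D≈b)) (frobenius-E j) ⟩
        aⱼ * bⱼ * (frobenius j b * Sⱼ + frobenius j a * Sⱼ₊₁)
          ≈⟨ solve 6 (λ aⱼ bⱼ fb fa S S′ → aⱼ :* bⱼ :* (fb :* S :+ fa :* S′)
               := aⱼ :* (bⱼ :* fb) :* S :+ aⱼ :* fa :* bⱼ :* S′) refl aⱼ bⱼ _ _ Sⱼ Sⱼ₊₁ ⟩
        aⱼ * (bⱼ * frobenius j b) * Sⱼ + aⱼ * frobenius j a * bⱼ * Sⱼ₊₁
          ≈⟨ +-cong (*-congʳ (*-congˡ (b-powers j j<m))) (*-congʳ (*-congʳ (a-powers j))) ⟩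
        U j + U (suc j) ∎
        where
        aⱼ = a ^ (2 ℕ.^ j ℕ.∸ 1)
        bⱼ = b ^ (q ℕ.∸ 2 ℕ.^ suc j)
        Sⱼ = frobenius j S
        Sⱼ₊₁ = frobenius (suc j) S

    -- Once `T` is S + O and `S` is P + w, the terms in `B * S` and in the power of `w` occur twice.
    -- `γα≈1` then pairs the terms in `O * B`, and `Bβ≈β` those in the power of `P`.
    total : γ * (β * frobenius m′ w + α * x) + (T + γ * (β * frobenius m′ P + α * O)) * B
            + (B * S + γ * β * frobenius m′ S) ≈ x
    total = begin
      γ * (β * Rw + α * x) + (T + γ * (β * RP + α * O)) * B + (B * S + γ * β * frobenius m′ S)
        ≈⟨ +-cong (+-congˡ (*-congʳ (+-congʳ T≈S+O))) (+-congˡ (*-congˡ RS≈RP+Rw)) ⟩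
      γ * (β * Rw + α * x) + (S + O + γ * (β * RP + α * O)) * B + (B * S + γ * β * (RP + Rw))
        ≈⟨ solve 9 (λ γ α β B x Rw RP S O →
             γ :* (β :* Rw :+ α :* x) :+ (S :+ O :+ γ :* (β :* RP :+ α :* O)) :* B
               :+ (B :* S :+ γ :* β :* (RP :+ Rw))
             := γ :* α :* (x :+ O :* B) :+ O :* B :+ (B :* β :+ β) :* (γ :* RP))
             refl γ α β B x Rw RP S O ⟩
      γ * α * (x + O * B) + O * B + (B * β + β) * (γ * RP)
        ≈⟨ +-cong (+-congʳ (*-congʳ γα≈1)) (*-congʳ (+-congʳ Bβ≈β)) ⟩
      1# * (x + O * B) + O * B + (β + β) * (γ * RP)
        ≈⟨ solve 4 (λ x O β z → con true :* (x :+ O) :+ O :+ (β :+ β) :* z := x) refl x (O * B) β (γ * RP) ⟩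
      x ∎
      where
      Rw = frobenius m′ w
      RP = frobenius m′ P
      RS≈RP+Rw : frobenius m′ S ≈ RP + Rw
      RS≈RP+Rw = trans (frobenius-cong m′ S≈P+w) (frobenius-+ m′ P w)

  -- From the identity at y = F(x) to the two-sided inverse.

  module _ (l : Vector k.Carrier m) (g : List k.Carrier)
    (g-inverse : k.IsCompositionalInverse (λ x → x k.* k.linearized l x) (k.eval g))
    (a₀ : k.Carrier) (a₀#0 : a₀ k.# k.0#) where

    private
      a = ι a₀
      L = linearized (ι ∘ l)
      L-cong = linearized-cong (ι ∘ l)

    -- Covers trace 0, where the convention 1/0 = 0 makes the quotient 0 and it has to agree with
    -- L(0).
    L-0# : L 0# ≈ 0#
    L-0# = trans
      (sum-cong-≋ {m} (λ i → trans (*-congˡ {ι (l i)} (frobenius-0# (toℕ i))) (zeroʳ _)))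
      (Sum.sum-replicate-zero +-commutativeMonoid m)

    F-cong : Congruent _≈_ _≈_ (F l a₀)
    F-cong x≈y = *-cong x≈y (+-cong (+-cong (L-cong (Tr-cong x≈y)) (*-congˡ (Tr-cong x≈y))) (*-congˡ x≈y))

    F⁻¹∘F : ∀ {x y} → y ≈ F l a₀ x → F⁻¹ g a₀ y ≈ x
    F⁻¹∘F {x} {y} y≈Fx = begin
      F⁻¹ g a₀ y
        ≈⟨ +-cong (+-cong (*-congˡ first) (*-cong (+-cong gT≈T (*-congˡ second)) (^-congˡ (q ℕ.∸ 1) D≈b)))
                   (third D≈b) ⟩
      γ * (β * frobenius m′ w + α * x) + (T + γ * (β * frobenius m′ P + α * O)) * B
        + (B * S + γ * β * frobenius m′ S)   ≈⟨ total ⟩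
      x ∎
      where
      b = L (Tr x) + a * Tr x

      -- The trace comes from some `t` in `k`, where `g` is known to invert the map x L(x).
      t = proj₁ (fixed⇒ι (Tr-fixed x))

      Tr≈ιt : Tr x ≈ ι t
      Tr≈ιt = proj₂ (fixed⇒ι (Tr-fixed x))

      LT≈ι : L (Tr x) ≈ ι (k.linearized l t)
      LT≈ι = trans (L-cong Tr≈ιt) (sym (ι-linearized l t))

      b-fixed : Fixed b
      b-fixed = ι-fixed {u = k.linearized l t k.+ a₀ k.* t} (sym (trans (ι-+ _ _)
        (+-cong (sym LT≈ι) (trans (ι-* a₀ t) (*-congˡ (sym Tr≈ιt))))))

      y≈bx+ax² : y ≈ b * x + a * (x * x)
      y≈bx+ax² = trans y≈Fx
        (solve 3 (λ b a x → x :* (b :+ a :* x) := b :* x :+ a :* (x :* x)) refl b a x)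

      open Preimage {a} {b} {x} {y} (ι-fixed refl) (ι-#0⇒≉0 a₀#0) b-fixed y≈bx+ax²

      Tr-y≈T*LT : Tr y ≈ T * L T
      Tr-y≈T*LT = trans Tr-y
        -- The two copies of aT² cancel.
        (solve 3 (λ L a T → (L :+ a :* T) :* T :+ a :* (T :* T) := T :* L) refl (L T) a T)

      gT = eval (map ι g) (Tr y)

      gT≈T : gT ≈ T
      gT≈T = begin
        eval (map ι g) (Tr y)
          ≈⟨ ι-eval g (trans Tr-y≈T*LT (trans (*-cong Tr≈ιt LT≈ι) (sym (ι-* t _)))) ⟩
        ι (k.eval g (t k.* k.linearized l t))  ≈⟨ ι-cong (proj₂ g-inverse k.refl) ⟩
        ι t                                    ≈⟨ Tr≈ιt ⟨
        T                                      ∎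

      D≈b : Tr y / gT + a * gT ≈ b
      D≈b = +-cong
        (/-unique (trans Tr-y≈T*LT (*-congʳ (sym gT≈T)))
          (λ gT≈0 → trans (L-cong (trans (sym gT≈T) gT≈0)) L-0#))
        (*-congˡ gT≈T)

    F-injective : Injective _≈_ _≈_ (F l a₀)
    F-injective Fx≈Fy = trans (sym (F⁻¹∘F refl)) (F⁻¹∘F Fx≈Fy)

    F-strictlySurjective : ∀ y → ∃[ x ] F l a₀ x ≈ y
    F-strictlySurjective = injective⇒strictlySurjective F-injective

    F-permutation : IsPermutation (F l a₀)
    F-permutation = F-injective , λ y →
      let x , Fx≈y = F-strictlySurjective y in x , λ z≈x → trans (F-cong z≈x) Fx≈y

    F⁻¹-inverse : IsCompositionalInverse (F l a₀) (F⁻¹ g a₀)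
    F⁻¹-inverse = F∘F⁻¹ , F⁻¹∘F
      where
      F∘F⁻¹ : ∀ {y z} → z ≈ F⁻¹ g a₀ y → F l a₀ z ≈ y
      -- Writing `y` as a value of `F` turns the left inverse into a right inverse.
      F∘F⁻¹ {y} z≈F⁻¹y = let x , Fx≈y = F-strictlySurjective y in
        trans (F-cong (trans z≈F⁻¹y (F⁻¹∘F (sym Fx≈y)))) Fx≈y

open import Data.Nat.Base using (NonZero; _^_)

theorem2p3 : ∀ {c ℓ₁ ℓ₂ c′ ℓ₁′ ℓ₂′ : Level}
    (m n : ℕ) .{{_ : NonZero m}} → 2 ∤ n →
    (k : FiniteField c ℓ₁ ℓ₂ (2 ^ m))
    (K : FiniteField c′ ℓ₁′ ℓ₂′ ((2 ^ m) ^ n)) →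
    let module k = FiniteField k
        module K = FiniteField K
    in
    (ι : k.Carrier → K.Carrier) → IsFieldEmbedding k K ι →
    let open Inversion m n k K ι in
    (l : Vector k.Carrier m) →
    k.IsPermutation (λ x → x k.* k.linearized l x) →
    (g : List k.Carrier) →
    k.IsCompositionalInverse (λ x → x k.* k.linearized l x) (k.eval g) →
    (a : k.Carrier) → a k.# k.0# →
    K.IsPermutation (F l a) × K.IsCompositionalInverse (F l a) (F⁻¹ g a)
theorem2p3 (suc m) n 2∤n k K ι ι-embedding l _ g g-inverse a a#0 =
  F-permutation l g g-inverse a a#0 , F⁻¹-inverse l g g-inverse a a#0
  where open InverseFormula m n (2∤n⇒n≡1+2h n 2∤n) k K ι ι-embedding
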